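{- Let $f$ be a formula. There exist a partial assignment $m$ and a derivation $\emptyset\parallel f\Longrightarrow^* m\parallel f$ in the classical DPLL transition system such that $m\parallel f$ is a final state, if and only if $f$ is satisfiable.
   Context: Fix a finite set $P$ of atoms. A literal is an atom $p\in P$ or its negation $\neg p$, with $\neg\neg p=p$. A clause is a finite list of literals, read as their disjunction; a formula (CNF) is a finite list of clauses, read as their conjunction. A partial assignment is an arbitrary finite list of literals, each annotated either as a decision literal (written $l^d$) or as a propagated literal (written $l$). New literals are appended on the right, $mn$ denotes concatenation, and $\emptyset$ is the empty list. Evaluation takes values in $\{T,F,U\}$ and ignores annotations; the rightmost occurrence of an atom takes precedence: $[\![l]\!]_m=T$ if the rightmost occurrence in $m$ of the atom of $l$ is as $l$, $F$ if it is as $\neg l$, and $U$ if the atom does not occur in $m$. For a clause $c$: $[\![c]\!]_m=T$ if some literal of $c$ evaluates to $T$, $F$ if all literals of $c$ evaluate to $F$, else $U$. For a formula $f$: $[\![f]\!]_m=T$ if all clauses evaluate to $T$, $F$ if some clause evaluates to $F$, else $U$. "True/false/undefined in $m$" means value $T/F/U$. $m$ satisfies $f$ (is a model of $f$) if $[\![f]\!]_m=T$; $f$ is satisfiable if it has a model. A state is either the distinguished state $\mathtt{fail}$ or a pair $m\parallel f$ of a partial assignment and a formula. The classical DPLL system is the relation $\Longrightarrow$ on states given by the rules (order within clauses and formulas being irrelevant for reading $c\lor l$, $f\land c$): UnitPropagate: $m\parallel f\land(c\lor l)\Longrightarrow m\,l\parallel f\land(c\lor l)$ if $c$ is false in $m$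 and $l$ is undefined in $m$. Decide: $m\parallel f\Longrightarrow m\,l^d\parallel f$ if $l$ or $\neg l$ occurs in a clause of $f$ and $l$ is undefined in $m$. Fail: $m\parallel f\land c\Longrightarrow\mathtt{fail}$ if $c$ is false in $m$ and $m$ contains no decision literals. Backtrack: $m\,l^d\,n\parallel f\land c\Longrightarrow m\,\neg l\parallel f\land c$ if $c$ is false in $m\,l^d\,n$ and $n$ contains no decision literals (the new $\neg l$ is propagated). Pure: $m\parallel f\Longrightarrow m\,l\parallel f$ if $l$ occurs in a clause of $f$, $\neg l$ occurs in no clause of $f$, and $l$ is undefined in $m$. $\Longrightarrow^*$ is the reflexive-transitive closure; sequences of transitions under it are derivations. A state $s$ is final if there is no $s'$ with $s\Longrightarrow s'$. -}

module Defs where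

open import Data.Bool using (if_then_else_)
open import Data.Fin using (Fin)
import Data.Fin.Properties as Fin
open import Data.List using (List; []; _∷_; _++_; _∷ʳ_; foldl)
open import Data.List.Membership.Propositional using (_∈_; _∉_)
open import Data.List.Relation.Binary.Permutation.Propositional using (_↭_)
open import Data.List.Relation.Unary.All using (all?)
open import Data.List.Relation.Unary.Any using (Any; any?)
open import Data.Nat using (ℕ)
open import Data.Product using (∃-syntax)
open import Data.Sum using (_⊎_)
open import Relation.Binary.Construct.Closure.ReflexiveTransitive using (Star)
open import Relation.Binary.Definitions using (DecidableEquality)
open import Relation.Binary.PropositionalEquality using (_≡_; refl; cong)
open import Relation.Nullary using (¬_; yes; no; does)
open import Relation.Nullary.Decidable using (map′)

infix  10 _ᵈ _ᵖ
infix  4  _∥_ _⊨_ _≟ˡ_ _≟ᵛ_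
infix  3  _⟹_ _⟹*_

-- The finite set of atoms is Fin n.
data Literal (n : ℕ) : Set where
  pos neg : Fin n → Literal n

private
  variable
    n : ℕ

~_ : Literal n → Literal n
~ pos p = neg p
~ neg p = pos p

infix 11 ~_

_≟ˡ_ : DecidableEquality (Literal n)
pos p ≟ˡ pos q = map′ (cong pos) (λ { refl → refl }) (p Fin.≟ q)
pos p ≟ˡ neg q = no λ ()
neg p ≟ˡ pos q = no λ ()
neg p ≟ˡ neg q = map′ (cong neg) (λ { refl → refl }) (p Fin.≟ q)

Clause : ℕ → Set
Clause n = List (Literal n)

Formula : ℕ → Set
Formula n = List (Clause n)

data AnnLiteral (n : ℕ) : Set where
  _ᵈ : Literal n → AnnLiteral n  -- decision
  _ᵖ : Literal n → AnnLiteral n  -- propagated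

literal : AnnLiteral n → Literal n
literal (l ᵈ) = l
literal (l ᵖ) = l

PartialAssignment : ℕ → Set
PartialAssignment n = List (AnnLiteral n)

data Value : Set where
  T F U : Value

_≟ᵛ_ : DecidableEquality Value
T ≟ᵛ T = yes refl
T ≟ᵛ F = no λ ()
T ≟ᵛ U = no λ ()
F ≟ᵛ T = no λ ()
F ≟ᵛ F = yes refl
F ≟ᵛ U = no λ ()
U ≟ᵛ T = no λ ()
U ≟ᵛ F = no λ ()
U ≟ᵛ U = yes refl

-- A left fold with overwriting: the rightmost occurrence of the atom of l wins.
evalLiteral : PartialAssignment n → Literal n → Value
evalLiteral m l = foldl overwrite U m
  where
  overwrite : Value → AnnLiteral _ → Value
  overwrite v a =
    if does (literal a ≟ˡ l) then T else
    if does (literal a ≟ˡ (~ l)) then F else v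

evalClause : PartialAssignment n → Clause n → Value
evalClause m c =
  if does (any? (λ l → evalLiteral m l ≟ᵛ T) c) then T else
  if does (all? (λ l → evalLiteral m l ≟ᵛ F) c) then F else U

evalFormula : PartialAssignment n → Formula n → Value
evalFormula m f =
  if does (all? (λ c → evalClause m c ≟ᵛ T) f) then T else
  if does (any? (λ c → evalClause m c ≟ᵛ F) f) then F else U

_⊨_ : PartialAssignment n → Formula n → Set
m ⊨ f = evalFormula m f ≡ T

Satisfiable : Formula n → Set
Satisfiable f = ∃[ m ] m ⊨ f

OccursIn : Literal n → Formula n → Set
OccursIn l f = Any (l ∈_) f

NoDecisions : PartialAssignment n → Set
NoDecisions m = ∀ l → l ᵈ ∉ m

data State (n : ℕ) : Set where
  fail : State n
  _∥_  : PartialAssignment n → Formula n → State n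

-- Reading a formula as f′ ∧ c, or a clause as c ∨ l, is up to permutation:
-- f ↭ f′ ∷ʳ c, respectively d ↭ c ∷ʳ l.
data _⟹_ {n : ℕ} : State n → State n → Set where

  unitPropagate : ∀ {m f f′ d c l} →
    f ↭ f′ ∷ʳ d → d ↭ c ∷ʳ l →
    evalClause m c ≡ F → evalLiteral m l ≡ U →
    m ∥ f ⟹ m ∷ʳ l ᵖ ∥ f

  decide : ∀ {m f l} →
    OccursIn l f ⊎ OccursIn (~ l) f →
    evalLiteral m l ≡ U →
    m ∥ f ⟹ m ∷ʳ l ᵈ ∥ f

  failing : ∀ {m f f′ c} →
    f ↭ f′ ∷ʳ c →
    evalClause m c ≡ F → NoDecisions m →
    m ∥ f ⟹ fail

  backtrack : ∀ {m l k f f′ c} →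
    f ↭ f′ ∷ʳ c →
    evalClause (m ++ l ᵈ ∷ k) c ≡ F → NoDecisions k →
    m ++ l ᵈ ∷ k ∥ f ⟹ m ∷ʳ (~ l) ᵖ ∥ f

  pure : ∀ {m f l} →
    OccursIn l f → ¬ OccursIn (~ l) f →
    evalLiteral m l ≡ U →
    m ∥ f ⟹ m ∷ʳ l ᵖ ∥ f

_⟹*_ : State n → State n → Set
_⟹*_ = Star _⟹_

Final : State n → Set
Final s = ¬ (∃[ s′ ] (s ⟹ s′))

{-# OPTIONS --safe #-}
-- A final state has no conflict (else Fail or Backtrack applies) and no undefined literal of f
-- (else Decide applies), so it satisfies f.  Conversely, given a model m₀ of f, no search is
-- needed: deciding the literals of f one after the other, always in agreement with m₀, leads to
-- an assignment that defines every literal of f and makes every clause true, hence to a final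
-- state.
module Submission where

open import Defs
open import Data.Bool using (if_then_else_)
open import Data.Empty using (⊥-elim)
open import Data.List using ([]; _∷_; _++_; _∷ʳ_; concat)
open import Data.List.Membership.Propositional using (_∈_; find; lose)
open import Data.List.Membership.Propositional.Properties
  using (∈-∃++; ∈-++⁺ʳ; ∈-concat⁺; ∈-concat⁻)
open import Data.List.Properties using (foldl-∷ʳ)
open import Data.List.Relation.Binary.Permutation.Propositional using (_↭_; ↭-sym; ↭-trans)
open import Data.List.Relation.Binary.Permutation.Propositional.Properties
  using (shift; ∷↭∷ʳ; ∈-resp-↭)
open import Data.List.Relation.Unary.All as All using (All; []; _∷_; all?)
open import Data.List.Relation.Unary.All.Properties using (¬All⇒Any¬)
open import Data.List.Relation.Unary.Any using (Any; here; there; any?)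
open import Data.List.Reverse using (Reverse; []; _∶_∶ʳ_; reverseView)
open import Data.Nat using (ℕ)
open import Data.Product using (∃-syntax; _×_; _,_)
open import Data.Sum using (_⊎_; inj₁; inj₂)
open import Function.Bundles using (_⇔_; mk⇔)
open import Relation.Binary.Construct.Closure.ReflexiveTransitive using (ε; _◅◅_; _◅_)
open import Relation.Binary.PropositionalEquality
  using (_≡_; _≢_; refl; sym; trans; cong; subst)
open import Relation.Nullary using (yes; no; does; contradiction)

private
  variable
    n : ℕ

~-involutive : (l : Literal n) → ~ ~ l ≡ l
~-involutive (pos p) = refl
~-involutive (neg p) = refl

~-injective : {k l : Literal n} → ~ k ≡ ~ l → k ≡ l
~-injective {k = k} {l} eq =
  trans (sym (~-involutive k)) (trans (cong ~_ eq) (~-involutive l))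

l≢~l : (l : Literal n) → l ≢ ~ l
l≢~l (pos p) ()
l≢~l (neg p) ()

negate : Value → Value
negate T = F
negate F = T
negate U = U

evalLiteral-∷ʳ : (m : PartialAssignment n) (a : AnnLiteral n) (l : Literal n) →
  evalLiteral (m ∷ʳ a) l ≡
    (if does (literal a ≟ˡ l) then T else
     if does (literal a ≟ˡ (~ l)) then F else evalLiteral m l)
evalLiteral-∷ʳ m a l = foldl-∷ʳ _ U a m

-- Induction from the right, since the rightmost occurrence takes precedence: the last literal
-- cannot be both `l` and `~ l`, and if it is neither, both values are inherited.
evalLiteral-~ : (m : PartialAssignment n) (l : Literal n) →
  evalLiteral m (~ l) ≡ negate (evalLiteral m l)
evalLiteral-~ m l = go (reverseView m)
  where
  go : ∀ {m} → Reverse m → evalLiteral m (~ l) ≡ negate (evalLiteral m l)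
  go [] = refl
  go (m ∶ r ∶ʳ a)
    rewrite evalLiteral-∷ʳ m a l | evalLiteral-∷ʳ m a (~ l) | go r | ~-involutive l
    with literal a ≟ˡ l | literal a ≟ˡ (~ l)
  ... | yes p | yes q = contradiction (trans (sym p) q) (l≢~l l)
  ... | yes _ | no _  = refl
  ... | no _  | yes _ = refl
  ... | no _  | no _  = refl

evalLiteral-∷ʳ-defined : (m : PartialAssignment n) (a : AnnLiteral n) {l : Literal n} →
  evalLiteral m l ≢ U ⊎ literal a ≡ l ⊎ literal a ≡ ~ l → evalLiteral (m ∷ʳ a) l ≢ U
evalLiteral-∷ʳ-defined m a {l} h eq
  rewrite evalLiteral-∷ʳ m a l
  with literal a ≟ˡ l | literal a ≟ˡ (~ l) | h
-- In the omitted cases `a` matches `l` or `~ l`, so `eq` would equate `T` or `F` with `U`.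
... | no _  | no _  | inj₁ d        = d eq
... | no ¬p | no _  | inj₂ (inj₁ p) = ¬p p
... | no _  | no ¬q | inj₂ (inj₂ q) = ¬q q

-- This keeps `Compatible` invariant under decisions: only the complement of the appended literal
-- can become newly false.
evalLiteral-∷ʳ-false : (m : PartialAssignment n) (a : AnnLiteral n) {l : Literal n} →
  evalLiteral (m ∷ʳ a) l ≡ F → literal a ≡ ~ l ⊎ evalLiteral m l ≡ F
evalLiteral-∷ʳ-false m a {l} eq
  rewrite evalLiteral-∷ʳ m a l
  with literal a ≟ˡ l | literal a ≟ˡ (~ l)
... | no _ | yes q = inj₁ q
... | no _ | no _  = inj₂ eq

module _ (m : PartialAssignment n) where

  evalClause-true⁺ : ∀ {c} → Any (λ l → evalLiteral m l ≡ T) c → evalClause m c ≡ T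
  evalClause-true⁺ {c} p with any? (λ l → evalLiteral m l ≟ᵛ T) c
  ... | yes _ = refl
  ... | no ¬p = contradiction p ¬p

  evalClause-true⁻ : ∀ {c} → evalClause m c ≡ T → Any (λ l → evalLiteral m l ≡ T) c
  evalClause-true⁻ {c} eq
    with any? (λ l → evalLiteral m l ≟ᵛ T) c | all? (λ l → evalLiteral m l ≟ᵛ F) c
  ... | yes p | _ = p
  evalClause-true⁻ () | no _ | yes _
  evalClause-true⁻ () | no _ | no _

  evalClause-undefined⁻ : ∀ {c} → evalClause m c ≡ U → ∃[ l ] (l ∈ c × evalLiteral m l ≡ U)
  evalClause-undefined⁻ {c} eq
    with any? (λ l → evalLiteral m l ≟ᵛ T) c | all? (λ l → evalLiteral m l ≟ᵛ F) c
  evalClause-undefined⁻ () | yes _ | _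
  evalClause-undefined⁻ () | no _ | yes _
  ... | no ¬t | no ¬f with find (¬All⇒Any¬ (λ l → evalLiteral m l ≟ᵛ F) _ ¬f)
  ... | l , l∈c , l≢F with evalLiteral m l in v
  ... | T = contradiction (lose l∈c v) ¬t
  ... | F = contradiction refl l≢F
  ... | U = l , l∈c , v

  ⊨⇒All : ∀ {f} → m ⊨ f → All (λ c → evalClause m c ≡ T) f
  ⊨⇒All {f} eq
    with all? (λ c → evalClause m c ≟ᵛ T) f | any? (λ c → evalClause m c ≟ᵛ F) f
  ... | yes p | _ = p
  ⊨⇒All () | no _ | yes _
  ⊨⇒All () | no _ | no _

-- The rules single out a clause or a literal as the last entry up to permutation; this lemma and
-- `↭∷ʳ⇒∈` translate between that form and membership.
∈⇒↭∷ʳ : ∀ {A : Set} {x : A} {xs} → x ∈ xs → ∃[ ys ] xs ↭ ys ∷ʳ x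
∈⇒↭∷ʳ {x = x} x∈xs with ∈-∃++ x∈xs
... | ys , zs , refl = ys ++ zs , ↭-trans (shift x ys zs) (∷↭∷ʳ x (ys ++ zs))

↭∷ʳ⇒∈ : ∀ {A : Set} {x : A} {xs ys} → xs ↭ ys ∷ʳ x → x ∈ xs
↭∷ʳ⇒∈ {ys = ys} p = ∈-resp-↭ (↭-sym p) (∈-++⁺ʳ ys (here refl))

-- Determines whether Fail or Backtrack answers a conflict. Splitting at the rightmost decision
-- gives the decision-free tail that Backtrack requires.
lastDecision : (m : PartialAssignment n) →
  NoDecisions m ⊎ ∃[ m₁ ] ∃[ l ] ∃[ k ] (m ≡ m₁ ++ l ᵈ ∷ k × NoDecisions k)
lastDecision [] = inj₁ λ _ ()
lastDecision (a ∷ m) with lastDecision m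
... | inj₂ (m₁ , l , k , refl , nd) = inj₂ (a ∷ m₁ , l , k , refl , nd)
lastDecision (l ᵈ ∷ m) | inj₁ nd = inj₂ ([] , l , m , refl , nd)
lastDecision (l ᵖ ∷ m) | inj₁ nd = inj₁ λ { k (there p) → nd k p }

conflict⇒step : {m : PartialAssignment n} {f : Formula n} {c : Clause n} →
  c ∈ f → evalClause m c ≡ F → ∃[ s ] (m ∥ f ⟹ s)
conflict⇒step {m = m} c∈f c≡F with ∈⇒↭∷ʳ c∈f | lastDecision m
... | _ , p | inj₁ nd                      = _ , failing p c≡F nd
... | _ , p | inj₂ (_ , _ , _ , refl , nd) = _ , backtrack p c≡F nd

final⇒⊨ : {m : PartialAssignment n} {f : Formula n} → Final (m ∥ f) → m ⊨ f
final⇒⊨ {m = m} {f} final with all? (λ c → evalClause m c ≟ᵛ T) f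
... | yes _ = refl
... | no ¬t with find (¬All⇒Any¬ (λ c → evalClause m c ≟ᵛ T) _ ¬t)
... | c , c∈f , c≢T with evalClause m c in v
... | T = contradiction refl c≢T
... | F = ⊥-elim (final (conflict⇒step c∈f v))
... | U with evalClause-undefined⁻ m v
... | l , l∈c , l≡U = ⊥-elim (final (_ , decide (inj₁ (lose c∈f l∈c)) l≡U))

-- UnitPropagate, Decide and Pure each need an undefined literal whose atom occurs in `f`; Fail and
-- Backtrack need a false clause.
complete⇒final : {m : PartialAssignment n} {f : Formula n} →
  (∀ {l} → OccursIn l f → evalLiteral m l ≢ U) →
  (∀ {c} → c ∈ f → evalClause m c ≡ T) → Final (m ∥ f)
complete⇒final def true (_ , unitPropagate p q _ l≡U) =
  def (lose (↭∷ʳ⇒∈ p) (↭∷ʳ⇒∈ q)) l≡U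
complete⇒final def true (_ , decide (inj₁ o) l≡U) = def o l≡U
complete⇒final {m = m} def true (_ , decide {l = l} (inj₂ o) l≡U) =
  def o (trans (evalLiteral-~ m l) (cong negate l≡U))
complete⇒final def true (_ , failing p c≡F _)
  with () ← trans (sym (true (↭∷ʳ⇒∈ p))) c≡F
complete⇒final def true (_ , backtrack p c≡F _)
  with () ← trans (sym (true (↭∷ʳ⇒∈ p))) c≡F
complete⇒final def true (_ , pure o _ l≡U) = def o l≡U

module _ (m₀ : PartialAssignment n) (f : Formula n) where

  -- Atoms undefined in m₀ may be decided either way, so only conflicts with m₀ are excluded.
  Compatible : PartialAssignment n → Set
  Compatible m = ∀ {l} → evalLiteral m l ≡ F → evalLiteral m₀ l ≢ T

  decideCompatibly : ∀ {m l} → Compatible m → OccursIn l f → evalLiteral m l ≡ U →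
    ∃[ k ] ((m ∥ f ⟹ m ∷ʳ k ᵈ ∥ f) × Compatible (m ∷ʳ k ᵈ) × (k ≡ l ⊎ k ≡ ~ l))
  decideCompatibly {m} {l} compat o l≡U with evalLiteral m₀ l ≟ᵛ T
  ... | yes l≡T = l , decide (inj₁ o) l≡U , compat′ , inj₁ refl
    where
    compat′ : Compatible (m ∷ʳ l ᵈ)
    compat′ {j} j≡F j≡T with evalLiteral-∷ʳ-false m (l ᵈ) j≡F
    ... | inj₂ j≡F′ = compat j≡F′ j≡T
    -- Here `l` is `~ j`, and `m₀` cannot make both `j` and `~ j` true.
    ... | inj₁ refl with () ← trans (sym l≡T) (trans (evalLiteral-~ m₀ j) (cong negate j≡T))
  -- Deciding `~ l` makes only `l` newly false, and `l` is not true in `m₀`; this covers `l`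
  -- undefined in `m₀` as well.
  ... | no l≢T =
    ~ l , decide (inj₂ (subst (λ k → OccursIn k f) (sym (~-involutive l)) o))
                 (trans (evalLiteral-~ m l) (cong negate l≡U))
        , compat′ , inj₂ refl
    where
    compat′ : Compatible (m ∷ʳ (~ l) ᵈ)
    compat′ {j} j≡F j≡T with evalLiteral-∷ʳ-false m ((~ l) ᵈ) j≡F
    ... | inj₂ j≡F′ = compat j≡F′ j≡T
    ... | inj₁ eq with refl ← ~-injective eq = l≢T j≡T

  -- Stated for a list `ls` of literals so that the induction can run while `f` stays fixed. A
  -- literal that is already defined costs no step; a new decision leaves defined literals defined.
  decideAll : ∀ {ls} → All (λ l → OccursIn l f) ls →
    ∃[ m ] (([] ∥ f ⟹* m ∥ f) × Compatible m × All (λ l → evalLiteral m l ≢ U) ls)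
  decideAll [] = [] , ε , (λ ()) , []
  decideAll {l ∷ ls} (o ∷ os) with decideAll os
  ... | m , steps , compat , def with evalLiteral m l ≟ᵛ U
  ... | no l≢U = m , steps , compat , l≢U ∷ def
  ... | yes l≡U with decideCompatibly compat o l≡U
  ... | k , step , compat′ , k≡±l =
    m ∷ʳ k ᵈ , steps ◅◅ step ◅ ε , compat′ ,
    evalLiteral-∷ʳ-defined m (k ᵈ) (inj₂ k≡±l) ∷
    All.map (λ d → evalLiteral-∷ʳ-defined m (k ᵈ) (inj₁ d)) def

  -- A literal of `c` true in `m₀` is defined in `m` and, by compatibility, not false there, so it
  -- is true in `m`.
  compatible⇒true : ∀ {m c} → Compatible m → All (λ l → evalLiteral m l ≢ U) c →
    evalClause m₀ c ≡ T → evalClause m c ≡ T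
  compatible⇒true {m} compat def c≡T with find (evalClause-true⁻ m₀ c≡T)
  ... | l , l∈c , l≡T with evalLiteral m l in v
  ... | T = evalClause-true⁺ m (lose l∈c v)
  ... | F = contradiction l≡T (compat v)
  ... | U = contradiction v (All.lookup def l∈c)

  ⊨⇒reachesFinal : m₀ ⊨ f → ∃[ m ] (([] ∥ f ⟹* m ∥ f) × Final (m ∥ f))
  -- `concat f` lists exactly the literals that occur in `f`.
  ⊨⇒reachesFinal sat with decideAll {concat f} (All.tabulate (∈-concat⁻ f))
  ... | m , steps , compat , def = m , steps , complete⇒final defined λ c∈f →
      compatible⇒true {m} compat (All.tabulate λ l∈c → defined (lose c∈f l∈c))
        (All.lookup (⊨⇒All m₀ sat) c∈f)
    where
    defined : ∀ {l} → OccursIn l f → evalLiteral m l ≢ U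
    defined o = All.lookup def (∈-concat⁺ o)

theorem35 : (n : ℕ) (f : Formula n) →
    (∃[ m ] (([] ∥ f ⟹* m ∥ f) × Final (m ∥ f))) ⇔ Satisfiable f
theorem35 n f = mk⇔
  (λ { (m , _ , final) → m , final⇒⊨ final })
  (λ { (m₀ , sat) → ⊨⇒reachesFinal m₀ f sat })
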